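{- Let $n\ge1$ and let $\alpha=(\alpha_t)_{t\ge2},\beta=(\beta_t)_{t\ge2},\gamma=(\gamma_t)_{t\ge2},\delta=(\delta_t)_{t\ge2}$ be sequences of nonnegative integers. The number of Type OC permutations $\sigma\in\mathfrak S_n$ with $\mathrm{nu}_t(\sigma)=\alpha_t$, $\mathrm{cu}_t(\sigma)=\beta_t$, $\mathrm{nl}_t(\sigma)=\gamma_t$, $\mathrm{cl}_t(\sigma)=\delta_t$ for all $t\ge2$ equals the number of Type OC permutations $\sigma\in\mathfrak S_n$ with $\mathrm{nu}_t(\sigma)=\beta_t$, $\mathrm{cu}_t(\sigma)=\alpha_t$, $\mathrm{nl}_t(\sigma)=\delta_t$, $\mathrm{cl}_t(\sigma)=\gamma_t$ for all $t\ge2$. That is, the label $(\mathrm{nu}_2,\dots;\mathrm{cu}_2,\dots;\mathrm{nl}_2,\dots;\mathrm{cl}_2,\dots)$ and the label $(\mathrm{cu}_2,\dots;\mathrm{nu}_2,\dots;\mathrm{cl}_2,\dots;\mathrm{nl}_2,\dots)$ are equidistributed over Type OC permutations of $[n]$.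
   Context: For $\sigma\in\mathfrak S_n$: the upper arcs of $\sigma$ are the pairs $(a,\sigma(a))$ with $a\le\sigma(a)$ (a fixed point gives a loop $(a,a)$); the lower arcs are the pairs $(\sigma(a),a)$ with $\sigma(a)<a$. An element $x\in[n]$ is an upper opener if $x\le\sigma(x)$, an upper closer if $\sigma^{ -1}(x)\le x$, a lower opener if $\sigma^{ -1}(x)>x$, and a lower closer if $\sigma(x)<x$. For $t\ge2$: an upper $t$-crossing (enhanced) is a set of $t$ upper arcs $(a_1,b_1),\dots,(a_t,b_t)$ with $a_1<\dots<a_t\le b_1<b_2<\dots<b_t$; an upper $t$-nesting (enhanced) is a set of $t$ upper arcs with $a_1<\dots<a_t\le b_t<b_{t-1}<\dots<b_1$; a lower $t$-crossing is a set of $t$ lower arcs $(c_1,d_1),\dots,(c_t,d_t)$ with $c_1<\dots<c_t<d_1<\dots<d_t$; a lower $t$-nesting is a set of $t$ lower arcs with $c_1<\dots<c_t<d_t<\dots<d_1$. Let $\mathrm{nu}_t(\sigma),\mathrm{cu}_t(\sigma),\mathrm{nl}_t(\sigma),\mathrm{cl}_t(\sigma)$ be the numbers of upper $t$-nestings, upper $t$-crossings, lower $t$-nestings and lower $t$-crossings of $\sigma$. $\sigma$ is of Type OC if there are integers $0=s_0<s_1<\dots<s_r=n$ such that each interval $I=[s_{q-1}+1,s_q]$ satisfies $\sigma(I)=I$ and: (a) every lower opener in $I$ is strictly smaller than every lower closer in $I$ (in particular no element is both); (b) there are no $x<y$ in $I$ with $x$ an upper closer and $y$ an upper opener. -}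

module Defs where

open import Data.Fin using (Fin; zero; suc; toℕ; fromℕ; inject₁; _≤_; _<_; _>_)
open import Data.Fin.Permutation using (Permutation′; _⟨$⟩ʳ_; _⟨$⟩ˡ_; _≈_)
open import Data.Fin.Properties using (_≟_; _≤?_; _<?_)
open import Data.List using (List; []; _∷_; [_]; _++_; map; filter; length; head; last; allFin; cartesianProduct)
open import Data.List.Relation.Unary.Linked using (Linked; linked?)
open import Data.Maybe.Relation.Binary.Connected using (Connected; connected?)
open import Data.Nat as ℕ using (ℕ)
open import Data.Product using (Σ; ∃; ∃-syntax; _×_; _,_; proj₁; proj₂)
open import Level using (0ℓ)
open import Relation.Binary using (Setoid)
open import Relation.Binary.PropositionalEquality using (_≡_; refl; sym; trans)
open import Relation.Nullary using (¬_)
open import Relation.Nullary.Decidable using (_×-dec_)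
open import Relation.Unary using (Pred; Decidable; _∈_; _≐_)

-- The ground set [n] is represented by Fin n, the element x of [n] being the
-- one with toℕ equal to x - 1.

Arc : ℕ → Set
Arc n = Fin n × Fin n

module _ {n : ℕ} (σ : Permutation′ n) where

  UpperArc : Pred (Arc n) 0ℓ
  UpperArc (a , b) = σ ⟨$⟩ʳ a ≡ b × a ≤ b

  LowerArc : Pred (Arc n) 0ℓ
  LowerArc (c , d) = σ ⟨$⟩ʳ d ≡ c × c < d

  upperArc? : Decidable UpperArc
  upperArc? (a , b) = (σ ⟨$⟩ʳ a ≟ b) ×-dec (a ≤? b)

  lowerArc? : Decidable LowerArc
  lowerArc? (c , d) = (σ ⟨$⟩ʳ d ≟ c) ×-dec (c <? d)

  UpperOpener UpperCloser LowerOpener LowerCloser : Pred (Fin n) 0ℓ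
  UpperOpener x = x ≤ σ ⟨$⟩ʳ x
  UpperCloser x = σ ⟨$⟩ˡ x ≤ x
  LowerOpener x = σ ⟨$⟩ˡ x > x
  LowerCloser x = σ ⟨$⟩ʳ x < x

  -- cartesianProduct lists pairs lexicographically, so the arcs below appear
  -- by increasing left endpoint (distinct arcs of the same kind have distinct
  -- left endpoints).

  upperArcs : List (Arc n)
  upperArcs = filter upperArc? (cartesianProduct (allFin n) (allFin n))

  lowerArcs : List (Arc n)
  lowerArcs = filter lowerArc? (cartesianProduct (allFin n) (allFin n))

-- The t-element subsets of a duplicate-free list, each represented once, by
-- its elements in the order of the list.

subsets : {A : Set} → ℕ → List A → List (List A)
subsets ℕ.zero    _        = [ [] ]
subsets (ℕ.suc t) []       = []
subsets (ℕ.suc t) (x ∷ xs) = map (x ∷_) (subsets t xs) ++ subsets (ℕ.suc t) xs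

-- For a list of arcs (a₁,b₁),…,(a_t,b_t) with t ≥ 1, Connected R (last _) (head _)
-- says that the last entry of the first list is R-related to the first of the
-- second; so the predicates are the chains
--   UpperCrossing   a₁ < … < a_t ≤ b₁ < … < b_t
--   UpperNesting    a₁ < … < a_t ≤ b_t < … < b₁
--   LowerCrossing   c₁ < … < c_t < d₁ < … < d_t
--   LowerNesting    c₁ < … < c_t < d_t < … < d₁

module _ {n : ℕ} where

  lefts rights : List (Arc n) → List (Fin n)
  lefts  = map proj₁
  rights = map proj₂

  UpperCrossing UpperNesting LowerCrossing LowerNesting : Pred (List (Arc n)) 0ℓ
  UpperCrossing s = Linked _<_ (lefts s) × Connected _≤_ (last (lefts s)) (head (rights s)) × Linked _<_ (rights s)
  UpperNesting  s = Linked _<_ (lefts s) × Connected _≤_ (last (lefts s)) (last (rights s)) × Linked _>_ (rights s)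
  LowerCrossing s = Linked _<_ (lefts s) × Connected _<_ (last (lefts s)) (head (rights s)) × Linked _<_ (rights s)
  LowerNesting  s = Linked _<_ (lefts s) × Connected _<_ (last (lefts s)) (last (rights s)) × Linked _>_ (rights s)

  upperCrossing? : Decidable UpperCrossing
  upperCrossing? s = linked? _<?_ _ ×-dec connected? _≤?_ _ _ ×-dec linked? _<?_ _

  upperNesting? : Decidable UpperNesting
  upperNesting? s = linked? _<?_ _ ×-dec connected? _≤?_ _ _ ×-dec linked? (λ x y → y <? x) _

  lowerCrossing? : Decidable LowerCrossing
  lowerCrossing? s = linked? _<?_ _ ×-dec connected? _<?_ _ _ ×-dec linked? _<?_ _

  lowerNesting? : Decidable LowerNesting
  lowerNesting? s = linked? _<?_ _ ×-dec connected? _<?_ _ _ ×-dec linked? (λ x y → y <? x) _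

  nu cu nl cl : ℕ → Permutation′ n → ℕ
  nu t σ = length (filter upperNesting?  (subsets t (upperArcs σ)))
  cu t σ = length (filter upperCrossing? (subsets t (upperArcs σ)))
  nl t σ = length (filter lowerNesting?  (subsets t (lowerArcs σ)))
  cl t σ = length (filter lowerCrossing? (subsets t (lowerArcs σ)))

-- The interval [l + 1 , u] of [n], after the shift to Fin n.

Interval : {n : ℕ} → ℕ → ℕ → Pred (Fin n) 0ℓ
Interval l u x = l ℕ.≤ toℕ x × toℕ x ℕ.< u

Image : {n : ℕ} → Permutation′ n → Pred (Fin n) 0ℓ → Pred (Fin n) 0ℓ
Image σ I y = ∃[ x ] x ∈ I × σ ⟨$⟩ʳ x ≡ y

record OCBlock {n : ℕ} (σ : Permutation′ n) (I : Pred (Fin n) 0ℓ) : Set where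
  field
    invariant : Image σ I ≐ I
    lower     : ∀ {x y} → x ∈ I → y ∈ I → LowerOpener σ x → LowerCloser σ y → x < y
    upper     : ¬ (∃[ x ] ∃[ y ] x ∈ I × y ∈ I × x < y × UpperCloser σ x × UpperOpener σ y)

record TypeOC {n : ℕ} (σ : Permutation′ n) : Set where
  field
    r          : ℕ
    s          : Fin (ℕ.suc r) → ℕ
    s-first    : s zero ≡ 0
    s-last     : s (fromℕ r) ≡ n
    increasing : (q : Fin r) → s (inject₁ q) ℕ.< s (suc q)
    block      : (q : Fin r) → OCBlock σ (Interval (s (inject₁ q)) (s (suc q)))

-- Sequences indexed by t ≥ 2 are functions on ℕ whose values at 0 and 1 are
-- never consulted.

HasLabel : {n : ℕ} (α β γ δ : ℕ → ℕ) → Pred (Permutation′ n) 0ℓ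
HasLabel α β γ δ σ = ∀ t → 2 ℕ.≤ t → nu t σ ≡ α t × cu t σ ≡ β t × nl t σ ≡ γ t × cl t σ ≡ δ t

-- The set of Type OC permutations with a given label. Equality only compares
-- the permutations (pointwise), so a permutation counts once however many
-- decompositions witness its type. For an arbitrary sequence the condition
-- "for all t ≥ 2" is not decidable, so the number of elements is not computed
-- as a numeral; two such sets have the same number of elements when there is
-- a Bijection between them.

OCPermutations : (n : ℕ) (α β γ δ : ℕ → ℕ) → Setoid 0ℓ 0ℓ
OCPermutations n α β γ δ = record
  { Carrier       = Σ (Permutation′ n) λ σ → TypeOC σ × HasLabel α β γ δ σ
  ; _≈_           = λ p q → proj₁ p ≈ proj₁ q
  ; isEquivalence = record
    { refl  = λ _ → refl
    ; sym   = λ e i → sym (e i)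
    ; trans = λ e f i → trans (e i) (f i)
    }
  }

{-# OPTIONS --safe #-}

-- In a Type OC permutation all upper arcs of a block overlap pairwise, and so do all its
-- lower arcs, while arcs of different blocks never overlap.  Hence the upper t-crossings
-- (t-nestings) are the increasing (decreasing) sequences of t upper arcs inside one block,
-- and likewise for lower arcs.  Let ρ reverse, in each block separately, the order of the
-- upper openers and the order of the lower closers.  Then σ ∘ ρ is of Type OC with the
-- same blocks, openers and closers, and crossings and nestings are exchanged.  The classes
-- reversed by ρ are determined by the overlaps, so ρ does not depend on the chosen
-- decomposition; as σ ∘ ρ has the same classes, σ ↦ σ ∘ ρ is an involution.

module Submission where

open import Defs
open import Data.Nat using (ℕ; _≤_)
open import Function.Bundles using (Bijection)
open import Data.Bool using (Bool)
import Data.Bool.Properties as Bool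
open import Data.Empty using (⊥-elim)
open import Data.Fin as Fin using (Fin; zero; suc; toℕ; fromℕ; inject₁; opposite)
open import Data.Fin.Induction using (<-wellFounded; >-wellFounded)
open import Data.Fin.Permutation using (Permutation′; _⟨$⟩ʳ_; _⟨$⟩ˡ_; _≈_; _∘ₚ_; permutation; inverseˡ; inverseʳ)
import Data.Fin.Properties as Fin
open import Data.List using (List; []; _∷_; map; filter; length; head; last; reverse; reverseAcc; lookup; allFin; cartesianProduct)
open import Data.List.Membership.Propositional using (_∈_)
open import Data.List.Membership.Propositional.Properties using (∈-map⁺; ∈-map⁻; ∈-filter⁺; ∈-filter⁻; ∈-++⁺ˡ; ∈-++⁺ʳ; ∈-++⁻; ∈-allFin; ∈-cartesianProduct⁺; ∈-lookup)
open import Data.List.Membership.Propositional.Properties.WithK using (unique∧set⇒bag)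
open import Data.List.Properties using (∷-injectiveʳ; length-map; length-reverse; map-∘; map-id-local; reverse-map; reverse-involutive)
open import Data.List.Relation.Binary.BagAndSetEquality using (∼bag⇒↭)
open import Data.List.Relation.Binary.Permutation.Propositional.Properties using (↭-length)
open import Data.List.Relation.Unary.All as All using (All; []; _∷_)
import Data.List.Relation.Unary.All.Properties as All
open import Data.List.Relation.Unary.AllPairs as AllPairs using (AllPairs; []; _∷_)
import Data.List.Relation.Unary.AllPairs.Properties as AllPairs
open import Data.List.Relation.Unary.Any as Any using (here; there)
import Data.List.Relation.Unary.Any.Properties as Any
open import Data.List.Relation.Unary.Linked as Linked using (Linked; []; [-]; _∷_)
import Data.List.Relation.Unary.Linked.Properties as Linked
open import Data.List.Relation.Unary.Unique.Propositional using (Unique)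
import Data.List.Relation.Unary.Unique.Propositional.Properties as Unique
open import Data.Maybe using (just)
open import Data.Maybe.Relation.Binary.Connected using (Connected; just; nothing; nothing-just)
import Data.Nat as ℕ
import Data.Nat.Properties as ℕ
open import Data.Product using (∃; ∃-syntax; _×_; _,_; proj₁; proj₂)
open import Data.Product.Properties using (≡-dec)
open import Data.Sum using (_⊎_; inj₁; inj₂)
open import Function using (_∘_; flip; mk⇔)
open import Induction.WellFounded using (Acc; acc)
open import Level using (0ℓ)
open import Relation.Binary using (Rel; Setoid; Asymmetric; DecidableEquality; tri<; tri≈; tri>)
open import Relation.Binary.PropositionalEquality using (_≡_; _≢_; refl; sym; trans; cong; cong₂; subst; subst₂; setoid)
open import Relation.Nullary using (¬_; Dec; yes; no; does)
open import Relation.Nullary.Decidable using (does-⇔)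
open import Relation.Unary using (Pred; Decidable)

-- Order reversal of the fibres of a map

-- The two fields pin `ρ` down: a finite chain has only one strictly decreasing self-map, and it is
-- an involution.
record Reverses {n : ℕ} {K : Set} (κ : Fin n → K) (ρ : Fin n → Fin n) : Set where
  field
    fibre    : ∀ x → κ (ρ x) ≡ κ x
    antitone : ∀ {x y} → κ x ≡ κ y → x Fin.< y → ρ y Fin.< ρ x

module _ {n : ℕ} {K : Set} {κ : Fin n → K} where

  -- If `τ x < x`, applying `τ` inside the fibre gives `τ (τ x) < τ x`, and so on down forever;
  -- `x < τ x` climbs forever. Neither is possible in `Fin n`.
  fibrewise-increasing⇒identity : {τ : Fin n → Fin n} → (∀ x → κ (τ x) ≡ κ x) →
    (∀ {x y} → κ x ≡ κ y → x Fin.< y → τ x Fin.< τ y) → ∀ x → τ x ≡ x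
  fibrewise-increasing⇒identity {τ} fib inc x with Fin.<-cmp (τ x) x
  ... | tri< τx<x _ _ = ⊥-elim (descent (<-wellFounded x) τx<x)
    where
    descent : ∀ {x} → Acc Fin._<_ x → ¬ (τ x Fin.< x)
    descent {x} (acc rs) τx<x = descent (rs τx<x) (inc (fib x) τx<x)
  ... | tri≈ _ τx≡x _ = τx≡x
  ... | tri> _ _ x<τx = ⊥-elim (ascent (>-wellFounded x) x<τx)
    where
    ascent : ∀ {x} → Acc Fin._>_ x → ¬ (x Fin.< τ x)
    ascent {x} (acc rs) x<τx = ascent (rs x<τx) (inc (sym (fib x)) x<τx)

  -- Two strictly decreasing maps of a fibre compose to a strictly increasing one.
  reverses-cancel : ∀ {ρ ρ′} → Reverses κ ρ → Reverses κ ρ′ → ∀ x → ρ′ (ρ x) ≡ x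
  reverses-cancel {ρ} R R′ = fibrewise-increasing⇒identity
    (λ x → trans (R′.fibre (ρ x)) (R.fibre x))
    (λ e x<y → R′.antitone (trans (R.fibre _) (trans (sym e) (sym (R.fibre _)))) (R.antitone e x<y))
    where
    module R  = Reverses R
    module R′ = Reverses R′

  -- Reversal depends on the partition into fibres only, not on the labels; this makes different
  -- block numberings comparable.
  reverses-transport : {K′ : Set} {κ′ : Fin n → K′} → (∀ {x y} → κ x ≡ κ y → κ′ x ≡ κ′ y) →
    (∀ {x y} → κ′ x ≡ κ′ y → κ x ≡ κ y) → ∀ {ρ} → Reverses κ ρ → Reverses κ′ ρ
  reverses-transport to from R = record
    { fibre    = λ x → to (R.fibre x)
    ; antitone = λ e → R.antitone (from e)
    }
    where module R = Reverses R

  reverses-unique : ∀ {ρ ρ′} → Reverses κ ρ → Reverses κ ρ′ → ∀ x → ρ x ≡ ρ′ x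
  reverses-unique {ρ} {ρ′} R R′ x =
    trans (sym (reverses-cancel R′ R′ (ρ x))) (cong ρ′ (reverses-cancel R R′ x))

lookup-increasing : {A : Set} {_≺_ : Rel A 0ℓ} {xs : List A} → AllPairs _≺_ xs →
  ∀ {i j} → i Fin.< j → lookup xs i ≺ lookup xs j
lookup-increasing (x≺xs ∷ _)   {zero}  {suc j} _           = All.lookup x≺xs (∈-lookup j)
lookup-increasing (_ ∷ sorted) {suc i} {suc j} (ℕ.s≤s i<j) = lookup-increasing sorted i<j

opposite-antitone : ∀ {n} {i j : Fin n} → i Fin.< j → opposite j Fin.< opposite i
opposite-antitone {n} {i} {j} i<j = subst₂ ℕ._<_ (sym (Fin.opposite-prop j)) (sym (Fin.opposite-prop i))
  (ℕ.∸-monoʳ-< (ℕ.s≤s i<j) (Fin.toℕ<n j))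

module _ {n : ℕ} {K : Set} (_≟_ : DecidableEquality K) (κ : Fin n → K) where

  private
    members : K → List (Fin n)
    members k = filter (λ x → κ x ≟ k) (allFin n)

    members-increasing : ∀ k → AllPairs Fin._<_ (members k)
    members-increasing k = AllPairs.filter⁺ (λ x → κ x ≟ k) (AllPairs.tabulate⁺-< (λ i<j → i<j))

    member : ∀ {x k} → κ x ≡ k → x ∈ members k
    member {x} {k} e = ∈-filter⁺ (λ x → κ x ≟ k) (∈-allFin x) e

    rank : ∀ {x k} → κ x ≡ k → Fin (length (members k))
    rank e = Any.index (member e)

    rank-increasing : ∀ {x y k} (e : κ x ≡ k) (e′ : κ y ≡ k) → x Fin.< y → rank e Fin.< rank e′
    rank-increasing {x} {y} {k} e e′ x<y with Fin.<-cmp (rank e) (rank e′)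
    ... | tri< lt _ _ = lt
    ... | tri≈ _ eq _ = ⊥-elim (Fin.<-irrefl (trans (Any.lookup-index (member e))
            (trans (cong (lookup (members k)) eq) (sym (Any.lookup-index (member e′))))) x<y)
    ... | tri> _ _ gt = ⊥-elim (Fin.<-asym x<y (subst₂ Fin._<_
            (sym (Any.lookup-index (member e′))) (sym (Any.lookup-index (member e)))
            (lookup-increasing (members-increasing k) gt)))

    -- The label `k` is kept apart from `κ x` so that two elements of one fibre are ranked in
    -- literally the same list; `reflect-irrelevant` returns to the choice `refl`.
    reflect : ∀ {x k} → κ x ≡ k → Fin n
    reflect {k = k} e = lookup (members k) (opposite (rank e))

    reflect-antitone : ∀ {x y k} (e : κ x ≡ k) (e′ : κ y ≡ k) → x Fin.< y → reflect e′ Fin.< reflect e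
    reflect-antitone {k = k} e e′ x<y =
      lookup-increasing (members-increasing k) (opposite-antitone (rank-increasing e e′ x<y))

    reflect-irrelevant : ∀ {x k} (e : κ x ≡ k) → reflect e ≡ reflect {x} refl
    reflect-irrelevant refl = refl

  reversal : ∃ (Reverses κ)
  reversal = (λ x → reflect {x} refl) , record
    { fibre    = λ x → proj₂ (∈-filter⁻ (λ y → κ y ≟ κ x) {xs = allFin n} (∈-lookup (opposite (rank {x} refl))))
    ; antitone = λ {x} {y} e x<y → subst (Fin._< reflect {x} refl) (reflect-irrelevant (sym e))
                   (reflect-antitone refl (sym e) x<y)
    }

-- Counting subsets

module _ {A : Set} where

  ∈-subsets⁻ : ∀ t (xs : List A) {s} → s ∈ subsets t xs → length s ≡ t × All (_∈ xs) s
  ∈-subsets⁻ ℕ.zero    xs       (here refl) = refl , []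
  ∈-subsets⁻ (ℕ.suc t) (x ∷ xs) s∈ with ∈-++⁻ (map (x ∷_) (subsets t xs)) s∈
  ... | inj₂ s∈ʳ = let len , s⊆ = ∈-subsets⁻ (ℕ.suc t) xs s∈ʳ in len , All.map there s⊆
  ... | inj₁ s∈ˡ with ∈-map⁻ (x ∷_) s∈ˡ
  ...   | _ , u∈ , refl = let len , u⊆ = ∈-subsets⁻ t xs u∈ in cong ℕ.suc len , here refl ∷ All.map there u⊆

  subsets-unique : ∀ t {xs : List A} → Unique xs → Unique (subsets t xs)
  subsets-unique ℕ.zero    _  = [] ∷ []
  subsets-unique (ℕ.suc t) [] = []
  subsets-unique (ℕ.suc t) {x ∷ xs} (x∉ ∷ xs!) = Unique.++⁺
    (Unique.map⁺ ∷-injectiveʳ (subsets-unique t xs!)) (subsets-unique (ℕ.suc t) xs!) disjoint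
    where
    disjoint : ∀ {s} → ¬ (s ∈ map (x ∷_) (subsets t xs) × s ∈ subsets (ℕ.suc t) xs)
    disjoint (s∈ˡ , s∈ʳ) with ∈-map⁻ (x ∷_) s∈ˡ | proj₂ (∈-subsets⁻ (ℕ.suc t) xs s∈ʳ)
    ... | _ , _ , refl | x∈xs ∷ _ = All.lookup x∉ x∈xs refl

  module _ {_≺_ : Rel A 0ℓ} (asym : Asymmetric _≺_) where

    private
      drop-head : ∀ {x : A} {xs s : List A} → All (x ≢_) s → All (_∈ (x ∷ xs)) s → All (_∈ xs) s
      drop-head []        []              = []
      drop-head (x≢ ∷ _)  (here refl ∷ _) = ⊥-elim (x≢ refl)
      drop-head (_ ∷ x≢s) (there y∈ ∷ s⊆) = y∈ ∷ drop-head x≢s s⊆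

    -- `subsets` presents each subset in the order of `xs` only, hence the sortedness of both lists.
    -- Whether or not the heads agree, asymmetry keeps `x` out of the tail of `s`, so the recursion
    -- may drop it from `xs`.
    ∈-subsets⁺ : ∀ {xs s} → AllPairs _≺_ xs → AllPairs _≺_ s → All (_∈ xs) s → s ∈ subsets (length s) xs
    ∈-subsets⁺ {s = []} _ _ _ = here refl
    ∈-subsets⁺ {x ∷ xs} {y ∷ s} (x≺ ∷ xs↗) (y≺ ∷ s↗) (here refl ∷ s⊆) =
      ∈-++⁺ˡ (∈-map⁺ (x ∷_) (∈-subsets⁺ xs↗ s↗ (drop-head (All.map (λ { x≺z refl → asym x≺z x≺z }) y≺) s⊆)))
    ∈-subsets⁺ {x ∷ xs} {y ∷ s} (x≺ ∷ xs↗) (y≺ ∷ s↗) (there y∈ ∷ s⊆) =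
      ∈-++⁺ʳ (map (x ∷_) (subsets (length s) xs))
        (∈-subsets⁺ xs↗ (y≺ ∷ s↗) (y∈ ∷ drop-head (All.map (λ { y≺z refl → asym (All.lookup x≺ y∈) y≺z }) y≺) s⊆))

  -- An involution is injective, so `map f xs` is duplicate-free with the same members as `ys`; such
  -- lists are permutations of each other.
  length-≡-by-involution : {f : A → A} → (∀ x → f (f x) ≡ x) → {xs ys : List A} → Unique xs → Unique ys →
    (∀ {x} → x ∈ xs → f x ∈ ys) → (∀ {y} → y ∈ ys → f y ∈ xs) → length xs ≡ length ys
  length-≡-by-involution {f} inv {xs} {ys} xs! ys! to from = trans (sym (length-map f xs))
    (↭-length (∼bag⇒↭ (unique∧set⇒bag (Unique.map⁺ injective xs!) ys! (mk⇔ to′ from′))))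
    where
    injective : ∀ {x y} → f x ≡ f y → x ≡ y
    injective e = trans (sym (inv _)) (trans (cong f e) (inv _))
    to′ : ∀ {z} → z ∈ map f xs → z ∈ ys
    to′ z∈ with ∈-map⁻ f z∈
    ... | _ , x∈ , refl = to x∈
    from′ : ∀ {z} → z ∈ ys → z ∈ map f xs
    from′ z∈ = subst (_∈ map f xs) (inv _) (∈-map⁺ f (from z∈))

module _ {n : ℕ} where

  _<ₗₑₓ_ : Rel (Arc n) 0ℓ
  p <ₗₑₓ q = proj₁ p Fin.< proj₁ q ⊎ (proj₁ p ≡ proj₁ q × proj₂ p Fin.< proj₂ q)

  <ₗₑₓ-asym : Asymmetric _<ₗₑₓ_
  <ₗₑₓ-asym (inj₁ p)       (inj₁ q)       = Fin.<-asym p q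
  <ₗₑₓ-asym (inj₁ p)       (inj₂ (e , _)) = Fin.<-irrefl (sym e) p
  <ₗₑₓ-asym (inj₂ (e , _)) (inj₁ q)       = Fin.<-irrefl (sym e) q
  <ₗₑₓ-asym (inj₂ (_ , p)) (inj₂ (_ , q)) = Fin.<-asym p q

  cartesianProduct-increasing : ∀ {xs ys : List (Fin n)} → AllPairs Fin._<_ xs → AllPairs Fin._<_ ys →
    AllPairs _<ₗₑₓ_ (cartesianProduct xs ys)
  cartesianProduct-increasing [] _ = []
  cartesianProduct-increasing {x ∷ xs} {ys} (x< ∷ xs↗) ys↗ = AllPairs.++⁺
    (AllPairs.map⁺ (AllPairs.map (λ lt → inj₂ (refl , lt)) ys↗))
    (cartesianProduct-increasing xs↗ ys↗)
    (All.map⁺ (All.universal (λ _ → All.cartesianProduct⁺ (setoid _) (setoid _) xs ys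
      (λ x′∈ _ → inj₁ (All.lookup x< x′∈))) ys))

  private
    allArcs : List (Arc n)
    allArcs = cartesianProduct (allFin n) (allFin n)

  module _ {G : Pred (Arc n) 0ℓ} (G? : Decidable G) where

    private
      arcs : List (Arc n)
      arcs = filter G? allArcs

      arcs-increasing : AllPairs _<ₗₑₓ_ arcs
      arcs-increasing = AllPairs.filter⁺ G? (cartesianProduct-increasing increasing increasing)
        where
        increasing : AllPairs Fin._<_ (allFin n)
        increasing = AllPairs.tabulate⁺-< (λ i<j → i<j)

    arcSubsets-unique : ∀ t → Unique (subsets t arcs)
    arcSubsets-unique t = subsets-unique t
      (Unique.filter⁺ G? (Unique.cartesianProduct⁺ (Unique.allFin⁺ n) (Unique.allFin⁺ n)))

    -- Increasing left endpoints already put `s` in the lexicographic order in which the arcs are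
    -- listed.
    ∈-arcSubsets⁺ : ∀ t {s} → length s ≡ t → All G s → Linked Fin._<_ (lefts s) → s ∈ subsets t arcs
    ∈-arcSubsets⁺ _ refl gs ls = ∈-subsets⁺ <ₗₑₓ-asym arcs-increasing
      (AllPairs.map inj₁ (AllPairs.map⁻ (Linked.Linked⇒AllPairs Fin.<-trans ls)))
      (All.map (∈-filter⁺ G? (∈-cartesianProduct⁺ (∈-allFin _) (∈-allFin _))) gs)

    ∈-arcSubsets⁻ : ∀ t {s} → s ∈ subsets t arcs → length s ≡ t × All G s
    ∈-arcSubsets⁻ t s∈ = let len , s⊆ = ∈-subsets⁻ t arcs s∈ in
      len , All.map (λ p∈ → proj₂ (∈-filter⁻ G? {xs = allArcs} p∈)) s⊆

  module _ {G H : Pred (Arc n) 0ℓ} (G? : Decidable G) (H? : Decidable H)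
           {P Q : Pred (List (Arc n)) 0ℓ} (P? : Decidable P) (Q? : Decidable Q)
           (P-lefts : ∀ {s} → P s → Linked Fin._<_ (lefts s))
           (Q-lefts : ∀ {s} → Q s → Linked Fin._<_ (lefts s))
           {f : List (Arc n) → List (Arc n)}
           (involutive : ∀ s → f (f s) ≡ s) (length-f : ∀ s → length (f s) ≡ length s)
           (to   : ∀ {s} → All G s → P s → All H (f s) × Q (f s))
           (from : ∀ {s} → All H s → Q s → All G (f s) × P (f s)) where

    -- Both patterns force increasing left endpoints, so the list `f s` occurs verbatim among the
    -- listed subsets on the other side. No further sorting intervenes, and `f` can be an involution
    -- on lists.
    arcSubsets-equinumerous : ∀ t → length (filter P? (subsets t (filter G? allArcs)))
                                  ≡ length (filter Q? (subsets t (filter H? allArcs)))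
    arcSubsets-equinumerous t = length-≡-by-involution involutive
      (Unique.filter⁺ P? (arcSubsets-unique G? t)) (Unique.filter⁺ Q? (arcSubsets-unique H? t))
      to′ from′
      where
      to′ : ∀ {s} → s ∈ filter P? (subsets t (filter G? allArcs)) → f s ∈ filter Q? (subsets t (filter H? allArcs))
      to′ {s} s∈ with ∈-filter⁻ P? {xs = subsets t (filter G? allArcs)} s∈
      ... | s∈′ , Ps with ∈-arcSubsets⁻ G? t s∈′
      ... | len , Gs with to Gs Ps
      ... | Hfs , Qfs = ∈-filter⁺ Q? (∈-arcSubsets⁺ H? t (trans (length-f s) len) Hfs (Q-lefts Qfs)) Qfs
      from′ : ∀ {s} → s ∈ filter Q? (subsets t (filter H? allArcs)) → f s ∈ filter P? (subsets t (filter G? allArcs))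
      from′ {s} s∈ with ∈-filter⁻ Q? {xs = subsets t (filter H? allArcs)} s∈
      ... | s∈′ , Qs with ∈-arcSubsets⁻ H? t s∈′
      ... | len , Hs with from Hs Qs
      ... | Gfs , Pfs = ∈-filter⁺ P? (∈-arcSubsets⁺ G? t (trans (length-f s) len) Gfs (P-lefts Pfs)) Pfs

-- Crossings and nestings as monotone sequences

linked-reverse : {A : Set} {R : Rel A 0ℓ} {xs : List A} → Linked R xs → Linked (flip R) (reverse xs)
linked-reverse {A} {R} {[]}    []     = []
linked-reverse {A} {R} {_ ∷ _} linked = go linked [-]
  where
  go : ∀ {x xs acc} → Linked R (x ∷ xs) → Linked (flip R) (x ∷ acc) → Linked (flip R) (reverseAcc (x ∷ acc) xs)
  go [-]         rev = rev
  go (Rxy ∷ Rxs) rev = go Rxs (Rxy ∷ rev)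

all-reverse : {A : Set} {P : Pred A 0ℓ} {xs : List A} → All P xs → All P (reverse xs)
all-reverse pxs = All.tabulate (λ x∈ → All.lookup pxs (Any.reverse⁻ x∈))

-- One treatment of both kinds of arcs: `_⊑_` becomes `≤` for upper arcs and `<` for lower ones. The
-- last two hypotheses say that arcs share a class exactly when each begins before the other ends.
module Chains {n : ℕ} {K : Set} (_⊑_ : Rel (Fin n) 0ℓ)
              (<-⊑-trans : ∀ {x y z} → x Fin.< y → y ⊑ z → x ⊑ z)
              (⊑-<-trans : ∀ {x y z} → x ⊑ y → y Fin.< z → x ⊑ z)
              (IsArc : Pred (Arc n) 0ℓ) (class : Arc n → K)
              (class⇒overlap : ∀ {p q} → IsArc p → IsArc q → class p ≡ class q → proj₁ p ⊑ proj₂ q)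
              (overlap⇒class : ∀ {p q} → IsArc p → IsArc q → proj₁ p ⊑ proj₂ q → proj₁ q ⊑ proj₂ p →
                               class p ≡ class q) where

  Crossing Nesting : Pred (List (Arc n)) 0ℓ
  Crossing s = Linked Fin._<_ (lefts s) × Connected _⊑_ (last (lefts s)) (head (rights s)) × Linked Fin._<_ (rights s)
  Nesting  s = Linked Fin._<_ (lefts s) × Connected _⊑_ (last (lefts s)) (last (rights s)) × Linked Fin._>_ (rights s)

  -- Equality of classes replaces the condition linking the last left endpoint to a right endpoint.
  -- Chains are then described by neighbours alone, a form that passes through `map` and `reverse`.
  Ascending Descending : Rel (Arc n) 0ℓ
  Ascending  p q = proj₁ p Fin.< proj₁ q × proj₂ p Fin.< proj₂ q × class p ≡ class q
  Descending p q = proj₁ p Fin.< proj₁ q × proj₂ q Fin.< proj₂ p × class p ≡ class q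

  private
    first-⊑ : ∀ {x xs y} → Linked Fin._<_ (x ∷ xs) → Connected _⊑_ (last (x ∷ xs)) (just y) → x ⊑ y
    first-⊑ [-]          (just x⊑y) = x⊑y
    first-⊑ (x<x′ ∷ xs↗) con        = <-⊑-trans x<x′ (first-⊑ xs↗ con)

    connected-mono : ∀ {m y z} → Connected _⊑_ m (just y) → y Fin.< z → Connected _⊑_ m (just z)
    connected-mono (just x⊑y)   y<z = just (⊑-<-trans x⊑y y<z)
    connected-mono nothing-just y<z = nothing-just

    -- With `b` the first arc of the chain, its class is carried along to the last arc, which
    -- therefore overlaps `b`.
    last-⊑ : ∀ {p s b} → IsArc b → All IsArc (p ∷ s) → Linked Ascending (p ∷ s) → class p ≡ class b →
      Connected _⊑_ (last (lefts (p ∷ s))) (just (proj₂ b))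
    last-⊑ gb (gp ∷ _) [-]                    e = just (class⇒overlap gp gb e)
    last-⊑ gb (_ ∷ gs) ((_ , _ , e′) ∷ asc) e = last-⊑ gb gs asc (trans (sym e′) e)

    last-arc : ∀ {s} → All IsArc s → Connected _⊑_ (last (lefts s)) (last (rights s))
    last-arc []              = nothing
    last-arc (g ∷ [])        = just (class⇒overlap g g refl)
    last-arc (_ ∷ gs@(_ ∷ _)) = last-arc gs

  crossing⇒ascending : ∀ {s} → All IsArc s → Crossing s → Linked Ascending s
  crossing⇒ascending []              _ = []
  crossing⇒ascending (_ ∷ [])        _ = [-]
  crossing⇒ascending (gp ∷ gs@(gq ∷ _)) (l< ∷ ls , con , r< ∷ rs) =
    -- The left end of `p` is `⊑` the right end of `p`, which is below that of `q`; the left end of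
    -- `q` is at most the last left end, which `con` puts `⊑` the right end of `p`.
    (l< , r< , overlap⇒class gp gq (⊑-<-trans (class⇒overlap gp gp refl) r<) (first-⊑ ls con))
    ∷ crossing⇒ascending gs (ls , connected-mono con r< , rs)

  ascending⇒crossing : ∀ {s} → All IsArc s → Linked Ascending s → Crossing s
  ascending⇒crossing gs asc =
      Linked.map⁺ (Linked.map proj₁ asc)
    , connected gs asc
    , Linked.map⁺ (Linked.map (proj₁ ∘ proj₂) asc)
    where
    connected : ∀ {s} → All IsArc s → Linked Ascending s → Connected _⊑_ (last (lefts s)) (head (rights s))
    connected []              _   = nothing
    connected gs@(g ∷ _) asc = last-⊑ g gs asc refl

  nesting⇒descending : ∀ {s} → All IsArc s → Nesting s → Linked Descending s
  nesting⇒descending []              _ = []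
  nesting⇒descending (_ ∷ [])        _ = [-]
  nesting⇒descending (gp ∷ gs@(gq ∷ _)) (l< ∷ ls , _ , r> ∷ rs) =
    -- The inner arc `q` lies within `p`, so `q⊑` extends to both overlaps.
    (l< , r> , overlap⇒class gp gq (<-⊑-trans l< q⊑) (⊑-<-trans q⊑ r>))
    ∷ nesting⇒descending gs (ls , last-arc gs , rs)
    where q⊑ = class⇒overlap gq gq refl

  descending⇒nesting : ∀ {s} → All IsArc s → Linked Descending s → Nesting s
  descending⇒nesting gs desc =
      Linked.map⁺ (Linked.map proj₁ desc)
    , last-arc gs
    , Linked.map⁺ (Linked.map (proj₁ ∘ proj₂) desc)

-- Block functions

-- The Type OC conditions for a block number on each element: `monotone` makes the fibres intervals,
-- and `upper` is condition (b) with its negation resolved.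
record Blocks {n : ℕ} (σ : Permutation′ n) (block : Fin n → ℕ) : Set where
  field
    closed   : ∀ x → block (σ ⟨$⟩ʳ x) ≡ block x
    monotone : ∀ {x y} → x Fin.≤ y → block x ℕ.≤ block y
    upper    : ∀ {x y} → block x ≡ block y → UpperOpener σ x → UpperCloser σ y → x Fin.≤ y
    lower    : ∀ {x y} → block x ≡ block y → LowerOpener σ x → LowerCloser σ y → x Fin.< y

-- The lower closers are exactly the elements that are not upper openers, so the fibres of
-- classOf are the sets of upper openers and of lower closers of the blocks.

classOf : ∀ {n} → Permutation′ n → (Fin n → ℕ) → Fin n → Bool × ℕ
classOf σ block x = does (x Fin.≤? (σ ⟨$⟩ʳ x)) , block x

does-≡⇒ : {A B : Set} (A? : Dec A) (B? : Dec B) → does A? ≡ does B? → A → B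
does-≡⇒ (yes _) (yes b) _  _ = b
does-≡⇒ (no ¬a) _       _  a = ⊥-elim (¬a a)

module _ {n : ℕ} (σ : Permutation′ n) (block : Fin n → ℕ) where

  class-opener : ∀ {x y} → classOf σ block x ≡ classOf σ block y → UpperOpener σ x → UpperOpener σ y
  class-opener e = does-≡⇒ (_ Fin.≤? _) (_ Fin.≤? _) (cong proj₁ e)

  class-closer : ∀ {x y} → classOf σ block x ≡ classOf σ block y → LowerCloser σ x → LowerCloser σ y
  class-closer e σx<x = ℕ.≰⇒> (λ y≤σy → ℕ.<⇒≱ σx<x (class-opener (sym e) y≤σy))

  class-upper : ∀ {x y} → block x ≡ block y → UpperOpener σ x → UpperOpener σ y →
    classOf σ block x ≡ classOf σ block y
  class-upper e x≤ y≤ = cong₂ _,_ (does-⇔ (mk⇔ (λ _ → y≤) (λ _ → x≤)) (_ Fin.≤? _) (_ Fin.≤? _)) e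

  class-lower : ∀ {x y} → block x ≡ block y → LowerCloser σ x → LowerCloser σ y →
    classOf σ block x ≡ classOf σ block y
  class-lower e x> y> = cong₂ _,_
    (does-⇔ (mk⇔ (λ x≤ → ⊥-elim (ℕ.<⇒≱ x> x≤)) (λ y≤ → ⊥-elim (ℕ.<⇒≱ y> y≤))) (_ Fin.≤? _) (_ Fin.≤? _)) e

module _ {n : ℕ} {σ : Permutation′ n} {block : Fin n → ℕ} (blocks : Blocks σ block) where

  open Blocks blocks

  closed⁻¹ : ∀ x → block (σ ⟨$⟩ˡ x) ≡ block x
  closed⁻¹ x = trans (sym (closed _)) (cong block (inverseʳ σ))

  -- The value of `σ` at the opener `y` is an upper closer in the block of `y`, so condition (b)
  -- applies to it and `x`.
  upper-overlap : ∀ {x y} → block x ≡ block y → UpperOpener σ x → UpperOpener σ y → x Fin.≤ (σ ⟨$⟩ʳ y)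
  upper-overlap {x} {y} e x≤ y≤ = upper (trans e (sym (closed y))) x≤
    (subst (Fin._≤ (σ ⟨$⟩ʳ y)) (sym (inverseˡ σ)) y≤)

  lower-overlap : ∀ {x y} → block x ≡ block y → LowerCloser σ x → LowerCloser σ y → (σ ⟨$⟩ʳ x) Fin.< y
  lower-overlap {x} {y} e x> y> = lower (trans (closed x) e)
    (subst ((σ ⟨$⟩ʳ x) Fin.<_) (sym (inverseˡ σ)) x>) y>

  -- Arcs stay inside their block and block numbers grow with the elements, so each inequality
  -- bounds one block number by the other.
  upper-block : ∀ {x y} → x Fin.≤ (σ ⟨$⟩ʳ y) → y Fin.≤ (σ ⟨$⟩ʳ x) → block x ≡ block y
  upper-block {x} {y} p q = ℕ.≤-antisym (subst (block x ℕ.≤_) (closed y) (monotone p))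
                                        (subst (block y ℕ.≤_) (closed x) (monotone q))

  lower-block : ∀ {x y} → (σ ⟨$⟩ʳ x) Fin.≤ y → (σ ⟨$⟩ʳ y) Fin.≤ x → block x ≡ block y
  lower-block {x} {y} p q = ℕ.≤-antisym (subst (ℕ._≤ block y) (closed x) (monotone p))
                                        (subst (ℕ._≤ block x) (closed y) (monotone q))

  private
    class⇒overlapᵘ : ∀ {p q} → UpperArc σ p → UpperArc σ q →
      classOf σ block (proj₁ p) ≡ classOf σ block (proj₁ q) → proj₁ p Fin.≤ proj₂ q
    class⇒overlapᵘ (refl , p≤) (refl , q≤) e = upper-overlap (cong proj₂ e) p≤ q≤

    overlap⇒classᵘ : ∀ {p q} → UpperArc σ p → UpperArc σ q → proj₁ p Fin.≤ proj₂ q → proj₁ q Fin.≤ proj₂ p →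
      classOf σ block (proj₁ p) ≡ classOf σ block (proj₁ q)
    overlap⇒classᵘ (refl , p≤) (refl , q≤) pq qp = class-upper σ block (upper-block pq qp) p≤ q≤

    class⇒overlapˡ : ∀ {p q} → LowerArc σ p → LowerArc σ q →
      classOf σ block (proj₂ p) ≡ classOf σ block (proj₂ q) → proj₁ p Fin.< proj₂ q
    class⇒overlapˡ (refl , p>) (refl , q>) e = lower-overlap (cong proj₂ e) p> q>

    overlap⇒classˡ : ∀ {p q} → LowerArc σ p → LowerArc σ q → proj₁ p Fin.< proj₂ q → proj₁ q Fin.< proj₂ p →
      classOf σ block (proj₂ p) ≡ classOf σ block (proj₂ q)
    overlap⇒classˡ (refl , p>) (refl , q>) pq qp =
      class-lower σ block (lower-block (ℕ.<⇒≤ pq) (ℕ.<⇒≤ qp)) p> q>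

  module UpperChains = Chains Fin._≤_ (λ p q → ℕ.≤-trans (ℕ.<⇒≤ p) q) (λ p q → ℕ.≤-trans p (ℕ.<⇒≤ q))
    (UpperArc σ) (classOf σ block ∘ proj₁) class⇒overlapᵘ overlap⇒classᵘ

  module LowerChains = Chains Fin._<_ ℕ.<-trans ℕ.<-trans
    (LowerArc σ) (classOf σ block ∘ proj₂) class⇒overlapˡ overlap⇒classˡ

-- Equal classes yield overlaps, which are inequalities about the permutation alone. They transfer
-- along `σ≈τ` and are read back as equal classes for the other block function.
classes-unique : ∀ {n} {σ τ : Permutation′ n} {b c : Fin n → ℕ} → Blocks σ b → Blocks τ c → σ ≈ τ →
  ∀ {x y} → classOf σ b x ≡ classOf σ b y → classOf τ c x ≡ classOf τ c y
classes-unique {σ = σ} {τ} {b} {c} B C σ≈τ {x} {y} e = cases (x Fin.≤? (σ ⟨$⟩ʳ x))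
  where
  same : b x ≡ b y
  same = cong proj₂ e

  ≤-transfer : ∀ {z w} → z Fin.≤ (σ ⟨$⟩ʳ w) → z Fin.≤ (τ ⟨$⟩ʳ w)
  ≤-transfer {z} {w} = subst (z Fin.≤_) (σ≈τ w)

  <-transfer : ∀ {z w} → (σ ⟨$⟩ʳ w) Fin.< z → (τ ⟨$⟩ʳ w) Fin.< z
  <-transfer {z} {w} = subst (Fin._< z) (σ≈τ w)

  cases : Dec (UpperOpener σ x) → _
  cases (yes x≤) = class-upper τ c
    (upper-block C (≤-transfer (upper-overlap B same x≤ y≤)) (≤-transfer (upper-overlap B (sym same) y≤ x≤)))
    (≤-transfer x≤) (≤-transfer y≤)
    where y≤ = class-opener σ b e x≤
  cases (no x≰) = class-lower τ c
    (lower-block C (ℕ.<⇒≤ (<-transfer (lower-overlap B same x> y>))) (ℕ.<⇒≤ (<-transfer (lower-overlap B (sym same) y> x>))))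
    (<-transfer x>) (<-transfer y>)
    where
    x> = ℕ.≰⇒> x≰
    y> = class-closer σ b e x>

-- Mirror images

-- A relation rather than a function: its symmetry and its single-valuedness up to `≈` give
-- well-definedness, injectivity and surjectivity of the reflection.
record Mirror {n : ℕ} (σ σ′ : Permutation′ n) (block : Fin n → ℕ) : Set where
  field
    ρ        : Fin n → Fin n
    blocks   : Blocks σ block
    blocks′  : Blocks σ′ block
    classes  : ∀ x → classOf σ′ block x ≡ classOf σ block x
    reverses : Reverses (classOf σ block) ρ
    image    : ∀ x → σ′ ⟨$⟩ʳ x ≡ σ ⟨$⟩ʳ ρ x

  open Reverses reverses public

  involutive : ∀ x → ρ (ρ x) ≡ x
  involutive = reverses-cancel reverses reverses

  image⁻ : ∀ x → σ′ ⟨$⟩ʳ ρ x ≡ σ ⟨$⟩ʳ x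
  image⁻ x = trans (image (ρ x)) (cong (σ ⟨$⟩ʳ_) (involutive x))

  class′ : ∀ x → classOf σ′ block (ρ x) ≡ classOf σ block x
  class′ x = trans (classes (ρ x)) (fibre x)

  class′-≡ : ∀ {x y} → classOf σ block x ≡ classOf σ block y → classOf σ′ block (ρ x) ≡ classOf σ′ block (ρ y)
  class′-≡ e = trans (class′ _) (trans e (sym (class′ _)))

-- The classes of `σ` and `σ′` coincide, so the same `ρ` reverses both, and precomposing with it
-- twice changes nothing.
mirror-sym : ∀ {n} {σ σ′ : Permutation′ n} {block} → Mirror σ σ′ block → Mirror σ′ σ block
mirror-sym M = record
  { ρ        = ρ
  ; blocks   = blocks′
  ; blocks′  = blocks
  ; classes  = λ x → sym (classes x)
  ; reverses = reverses-transport (λ e → trans (classes _) (trans e (sym (classes _))))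
                                  (λ e → trans (sym (classes _)) (trans e (classes _))) reverses
  ; image    = λ x → sym (image⁻ x)
  }
  where open Mirror M

-- The block functions may differ, but they induce the same partition into classes, and a partition
-- has only one reversal.
mirror-unique : ∀ {n} {σ σ′ τ τ′ : Permutation′ n} {b c} → Mirror σ σ′ b → Mirror τ τ′ c → σ ≈ τ → σ′ ≈ τ′
mirror-unique {σ = σ} {τ = τ} M N σ≈τ x = trans (M.image x) (trans (σ≈τ (M.ρ x))
  (trans (cong (τ ⟨$⟩ʳ_) (reverses-unique reversesᴺ N.reverses x)) (sym (N.image x))))
  where
  module M = Mirror M
  module N = Mirror N
  reversesᴺ = reverses-transport (classes-unique M.blocks N.blocks σ≈τ)
    (classes-unique N.blocks M.blocks (λ i → sym (σ≈τ i))) M.reverses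

mirror : ∀ {n} {σ : Permutation′ n} {block} → Blocks σ block → ∃[ σ′ ] Mirror σ σ′ block
mirror {n} {σ} {block} B = σ′ , record
  { ρ        = ρ
  ; blocks   = B
  ; blocks′  = record
    { closed   = λ x → trans (closed (ρ x)) (block-ρ x)
    ; monotone = monotone
    ; upper    = λ e x≤ ≤y → upper e (opener⁻ x≤) (upperCloser⁻ ≤y)
    ; lower    = λ e x< >y → lower e (lowerOpener⁻ x<) (closer⁻ >y)
    }
  ; classes  = λ x → cong (_, block x) (does-⇔ (mk⇔ (opener⁻ {x}) opener⁺) (_ Fin.≤? _) (_ Fin.≤? _))
  ; reverses = proj₂ reversed
  ; image    = λ _ → refl
  }
  where
  open Blocks B
  reversed : ∃ (Reverses (classOf σ block))
  reversed = reversal (≡-dec Bool._≟_ ℕ._≟_) (classOf σ block)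
  ρ = proj₁ reversed
  open Reverses (proj₂ reversed)

  involutive : ∀ x → ρ (ρ x) ≡ x
  involutive = reverses-cancel (proj₂ reversed) (proj₂ reversed)

  σ′ : Permutation′ n
  σ′ = permutation ρ ρ involutive involutive ∘ₚ σ

  block-ρ : ∀ x → block (ρ x) ≡ block x
  block-ρ x = cong proj₂ (fibre x)

  -- `ρ x` is again an opener of the block of `x`, and every opener there is at most the image of
  -- every other.
  opener⁺ : ∀ {x} → UpperOpener σ x → UpperOpener σ′ x
  opener⁺ {x} x≤ = upper-overlap B (sym (block-ρ x)) x≤ (class-opener σ block (sym (fibre x)) x≤)

  closer⁺ : ∀ {x} → LowerCloser σ x → LowerCloser σ′ x
  closer⁺ {x} x> = lower-overlap B (block-ρ x) (class-closer σ block (sym (fibre x)) x>) x>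

  -- Upper openers and lower closers are complementary, so each converse follows from the other
  -- forward implication.
  opener⁻ : ∀ {x} → UpperOpener σ′ x → UpperOpener σ x
  opener⁻ x≤ = ℕ.≮⇒≥ (λ x> → ℕ.<⇒≱ (closer⁺ x>) x≤)

  closer⁻ : ∀ {x} → LowerCloser σ′ x → LowerCloser σ x
  closer⁻ x> = ℕ.≰⇒> (λ x≤ → ℕ.<⇒≱ x> (opener⁺ x≤))

  -- An upper closer is the image of an upper opener. The preimage of `y` under `σ′` is
  -- `ρ (σ ⟨$⟩ˡ y)`, in the same class as its preimage under `σ`.
  upperCloser⁻ : ∀ {y} → UpperCloser σ′ y → UpperCloser σ y
  upperCloser⁻ {y} ≤y = subst ((σ ⟨$⟩ˡ y) Fin.≤_) (inverseʳ σ)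
    (class-opener σ block (fibre (σ ⟨$⟩ˡ y)) (opener⁻ (subst ((σ′ ⟨$⟩ˡ y) Fin.≤_) (sym (inverseʳ σ′)) ≤y)))

  lowerOpener⁻ : ∀ {y} → LowerOpener σ′ y → LowerOpener σ y
  lowerOpener⁻ {y} y< = subst (Fin._< (σ ⟨$⟩ˡ y)) (inverseʳ σ)
    (class-closer σ block (fibre (σ ⟨$⟩ˡ y)) (closer⁻ (subst (Fin._< (σ′ ⟨$⟩ˡ y)) (sym (inverseʳ σ′)) y<)))

-- Exchange of crossings and nestings

module _ {A : Set} {g : A → A} (g-involutive : ∀ p → g (g p) ≡ p) where

  map-involutive : ∀ s → map g (map g s) ≡ s
  map-involutive s = trans (sym (map-∘ s)) (map-id-local (All.universal g-involutive s))

  map-reverse-involutive : ∀ s → map g (reverse (map g (reverse s))) ≡ s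
  map-reverse-involutive s = trans (cong (map g) (trans (sym (reverse-map g (reverse s)))
    (cong (map g) (reverse-involutive s)))) (map-involutive s)

module Exchange {n : ℕ} {σ σ′ : Permutation′ n} {block : Fin n → ℕ} (M : Mirror σ σ′ block) where

  open Mirror M

  private
    module U  = UpperChains blocks
    module U′ = UpperChains blocks′
    module L  = LowerChains blocks
    module L′ = LowerChains blocks′

  -- `σ′` sends `ρ x` where `σ` sends `x`, so an arc keeps its target and its source moves by `ρ`.
  -- The source is the left end of an upper arc and the right end of a lower arc.
  moveLeft moveRight : Arc n → Arc n
  moveLeft  (a , b) = ρ a , b
  moveRight (c , d) = c , ρ d

  moveLeft-involutive : ∀ p → moveLeft (moveLeft p) ≡ p
  moveLeft-involutive (a , b) = cong (_, b) (involutive a)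

  moveRight-involutive : ∀ p → moveRight (moveRight p) ≡ p
  moveRight-involutive (c , d) = cong (c ,_) (involutive d)

  upperArc-moveLeft : ∀ {p} → UpperArc σ p → UpperArc σ′ (moveLeft p)
  upperArc-moveLeft {a , _} (refl , a≤) = image⁻ a , subst (ρ a Fin.≤_) (image⁻ a)
    (does-≡⇒ (_ Fin.≤? _) (_ Fin.≤? _) (cong proj₁ (sym (class′ a))) a≤)

  lowerArc-moveRight : ∀ {p} → LowerArc σ p → LowerArc σ′ (moveRight p)
  lowerArc-moveRight {_ , d} (refl , d>) = image⁻ d , subst (Fin._< ρ d) (image⁻ d)
    (ℕ.≰⇒> (λ ρd≤ → ℕ.<⇒≱ d> (does-≡⇒ (_ Fin.≤? _) (_ Fin.≤? _) (cong proj₁ (class′ d)) ρd≤)))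

  upperArcs-move : ∀ {s} → All (UpperArc σ) s → All (UpperArc σ′) (map moveLeft (reverse s))
  upperArcs-move gs = All.map⁺ (All.map upperArc-moveLeft (all-reverse gs))

  lowerArcs-move : ∀ {s} → All (LowerArc σ) s → All (LowerArc σ′) (map moveRight s)
  lowerArcs-move gs = All.map⁺ (All.map lowerArc-moveRight gs)

  -- `ρ` makes the left ends decrease, so the list is reversed to restore their order; the unmoved
  -- right ends then decrease.
  upperCrossing⇒nesting : ∀ {s} → All (UpperArc σ) s → UpperCrossing s →
    All (UpperArc σ′) (map moveLeft (reverse s)) × UpperNesting (map moveLeft (reverse s))
  upperCrossing⇒nesting gs cr = upperArcs-move gs , U′.descending⇒nesting (upperArcs-move gs)
    (Linked.map⁺ (Linked.map (λ (l< , r< , e) → antitone e l< , r< , class′-≡ (sym e))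
      (linked-reverse (U.crossing⇒ascending gs cr))))

  upperNesting⇒crossing : ∀ {s} → All (UpperArc σ) s → UpperNesting s →
    All (UpperArc σ′) (map moveLeft (reverse s)) × UpperCrossing (map moveLeft (reverse s))
  upperNesting⇒crossing gs ne = upperArcs-move gs , U′.ascending⇒crossing (upperArcs-move gs)
    (Linked.map⁺ (Linked.map (λ (l< , r> , e) → antitone e l< , r> , class′-≡ (sym e))
      (linked-reverse (U.nesting⇒descending gs ne))))

  -- Here the left ends stay in place and `ρ` flips the right ends, so the list keeps its order.
  lowerCrossing⇒nesting : ∀ {s} → All (LowerArc σ) s → LowerCrossing s →
    All (LowerArc σ′) (map moveRight s) × LowerNesting (map moveRight s)
  lowerCrossing⇒nesting gs cr = lowerArcs-move gs , L′.descending⇒nesting (lowerArcs-move gs)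
    (Linked.map⁺ (Linked.map (λ (l< , r< , e) → l< , antitone e r< , class′-≡ e)
      (L.crossing⇒ascending gs cr)))

  lowerNesting⇒crossing : ∀ {s} → All (LowerArc σ) s → LowerNesting s →
    All (LowerArc σ′) (map moveRight s) × LowerCrossing (map moveRight s)
  lowerNesting⇒crossing gs ne = lowerArcs-move gs , L′.ascending⇒crossing (lowerArcs-move gs)
    (Linked.map⁺ (Linked.map (λ (l< , r> , e) → l< , antitone (sym e) r> , class′-≡ e)
      (L.nesting⇒descending gs ne)))

module _ {n : ℕ} {σ σ′ : Permutation′ n} {block : Fin n → ℕ} (M : Mirror σ σ′ block) where

  private
    module E  = Exchange M
    module E′ = Exchange (mirror-sym M)

  cu≡nu : ∀ t → cu t σ ≡ nu t σ′
  cu≡nu = arcSubsets-equinumerous (upperArc? σ) (upperArc? σ′) upperCrossing? upperNesting? proj₁ proj₁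
    (map-reverse-involutive E.moveLeft-involutive)
    (λ s → trans (length-map _ (reverse s)) (length-reverse s))
    -- `mirror-sym` keeps `ρ`, so both directions use definitionally the same map on lists.
    E.upperCrossing⇒nesting E′.upperNesting⇒crossing

  cl≡nl : ∀ t → cl t σ ≡ nl t σ′
  cl≡nl = arcSubsets-equinumerous (lowerArc? σ) (lowerArc? σ′) lowerCrossing? lowerNesting? proj₁ proj₁
    (map-involutive E.moveRight-involutive) (length-map _)
    E.lowerCrossing⇒nesting E′.lowerNesting⇒crossing

mirror-label : ∀ {n} {σ σ′ : Permutation′ n} {block} {α β γ δ} → Mirror σ σ′ block →
  HasLabel α β γ δ σ → HasLabel β α δ γ σ′
mirror-label M label t 2≤t = let nu≡ , cu≡ , nl≡ , cl≡ = label t 2≤t in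
    trans (sym (cu≡nu M t)) cu≡
  , trans (cu≡nu (mirror-sym M) t) nu≡
  , trans (sym (cl≡nl M t)) cl≡
  , trans (cl≡nl (mirror-sym M) t) nl≡

-- Decompositions

private
  locate : ∀ r (s : Fin (ℕ.suc r) → ℕ) {x} → s zero ℕ.≤ x → x ℕ.< s (fromℕ r) →
    ∃[ q ] s (inject₁ q) ℕ.≤ x × x ℕ.< s (suc q)
  locate ℕ.zero    s s₀≤x x<s₀ = ⊥-elim (ℕ.<⇒≱ x<s₀ s₀≤x)
  locate (ℕ.suc r) s {x} s₀≤x x<sᵣ with x ℕ.<? s (suc zero)
  ... | yes x<s₁ = zero , s₀≤x , x<s₁
  ... | no  x≮s₁ = let q , l , u = locate r (s ∘ suc) (ℕ.≮⇒≥ x≮s₁) x<sᵣ in suc q , l , u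

  first-least : ∀ {r} (s : Fin (ℕ.suc r) → ℕ) → (∀ q → s (inject₁ q) ℕ.< s (suc q)) → ∀ i → s zero ℕ.≤ s i
  first-least s inc zero = ℕ.≤-refl
  first-least {r = ℕ.suc _} s inc (suc i) = ℕ.≤-trans (ℕ.<⇒≤ (inc zero)) (first-least (s ∘ suc) (inc ∘ suc) i)

  cuts-increasing : ∀ {r} (s : Fin (ℕ.suc r) → ℕ) → (∀ q → s (inject₁ q) ℕ.< s (suc q)) →
    ∀ {p q : Fin r} → p Fin.< q → s (suc p) ℕ.≤ s (inject₁ q)
  cuts-increasing s inc {zero}  {suc q} _           = first-least (s ∘ suc) (inc ∘ suc) (inject₁ q)
  cuts-increasing s inc {suc p} {suc q} (ℕ.s≤s p<q) = cuts-increasing (s ∘ suc) (inc ∘ suc) p<q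

module Decomposition {n : ℕ} {σ : Permutation′ n} (oc : TypeOC σ) where

  open TypeOC oc

  private
    located : (x : Fin n) → ∃[ q ] Interval (s (inject₁ q)) (s (suc q)) x
    located x = locate r s (subst (ℕ._≤ toℕ x) (sym s-first) ℕ.z≤n) (subst (toℕ x ℕ.<_) (sym s-last) (Fin.toℕ<n x))

    blockIndex : Fin n → Fin r
    blockIndex x = proj₁ (located x)

    intervals-ordered : ∀ {p q} {x y : Fin n} → Interval (s (inject₁ p)) (s (suc p)) x →
      Interval (s (inject₁ q)) (s (suc q)) y → x Fin.≤ y → p Fin.≤ q
    intervals-ordered (x≥ , _) (_ , y<) x≤y = ℕ.≮⇒≥ λ q<p →
      ℕ.<⇒≱ y< (ℕ.≤-trans (cuts-increasing s increasing q<p) (ℕ.≤-trans x≥ x≤y))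

  blockOf : Fin n → ℕ
  blockOf x = toℕ (blockIndex x)

  blockOf⁺ : ∀ q {x} → Interval (s (inject₁ q)) (s (suc q)) x → blockOf x ≡ toℕ q
  blockOf⁺ q {x} x∈ = ℕ.≤-antisym (intervals-ordered (proj₂ (located x)) x∈ ℕ.≤-refl)
                                  (intervals-ordered x∈ (proj₂ (located x)) ℕ.≤-refl)

  blockOf⁻ : ∀ q {x} → blockOf x ≡ toℕ q → Interval (s (inject₁ q)) (s (suc q)) x
  blockOf⁻ q {x} e = subst (λ q → Interval (s (inject₁ q)) (s (suc q)) x) (Fin.toℕ-injective e) (proj₂ (located x))

  decomposition-blocks : Blocks σ blockOf
  decomposition-blocks = record
    { closed   = λ x → blockOf⁺ (blockIndex x)
                   (proj₁ (OCBlock.invariant (block (blockIndex x))) (x , proj₂ (located x) , refl))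
    ; monotone = λ {x} {y} → intervals-ordered (proj₂ (located x)) (proj₂ (located y))
    ; upper    = λ {x} {y} e x≤ ≤y → ℕ.≮⇒≥ λ y<x → OCBlock.upper (block (blockIndex y))
                   (y , x , proj₂ (located y) , blockOf⁻ (blockIndex y) e , y<x , ≤y , x≤)
    ; lower    = λ {x} {y} e → OCBlock.lower (block (blockIndex y)) (blockOf⁻ (blockIndex y) e) (proj₂ (located y))
    }

  -- The cuts of `σ` are reused for `σ′`, which is why the mirror image is built over the same block
  -- function.
  blocks⇒typeOC : {σ′ : Permutation′ n} → Blocks σ′ blockOf → TypeOC σ′
  blocks⇒typeOC {σ′} B = record
    { r          = r
    ; s          = s
    ; s-first    = s-first
    ; s-last     = s-last
    ; increasing = increasing
    ; block      = λ q → record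
      { invariant = (λ { (x , x∈ , refl) → blockOf⁻ q (trans (B.closed x) (blockOf⁺ q x∈)) })
                  , (λ {y} y∈ → σ′ ⟨$⟩ˡ y , blockOf⁻ q (trans (closed⁻¹ B y) (blockOf⁺ q y∈)) , inverseʳ σ′)
      ; lower     = λ x∈ y∈ → B.lower (trans (blockOf⁺ q x∈) (sym (blockOf⁺ q y∈)))
      ; upper     = λ { (x , y , x∈ , y∈ , x<y , ≤x , y≤) →
                        ℕ.<⇒≱ x<y (B.upper (trans (blockOf⁺ q y∈) (sym (blockOf⁺ q x∈))) y≤ ≤x) }
      }
    }
    where module B = Blocks B

-- The bijection

module _ {n : ℕ} {α β γ δ : ℕ → ℕ} where

  private
    image-of : (p : Setoid.Carrier (OCPermutations n α β γ δ)) →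
      ∃[ σ′ ] Mirror (proj₁ p) σ′ (Decomposition.blockOf (proj₁ (proj₂ p)))
    image-of (_ , oc , _) = mirror (Decomposition.decomposition-blocks oc)

  reflectOC : Setoid.Carrier (OCPermutations n α β γ δ) → Setoid.Carrier (OCPermutations n β α δ γ)
  reflectOC p@(_ , oc , label) = let σ′ , M = image-of p in
    σ′ , Decomposition.blocks⇒typeOC oc (Mirror.blocks′ M) , mirror-label M label

  reflectOC-mirror : ∀ p → Mirror (proj₁ p) (proj₁ (reflectOC p)) (Decomposition.blockOf (proj₁ (proj₂ p)))
  reflectOC-mirror p = proj₂ (image-of p)

mainTheorem4 : (n : ℕ) → 1 ≤ n → (α β γ δ : ℕ → ℕ) →
    Bijection (OCPermutations n α β γ δ) (OCPermutations n β α δ γ)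
mainTheorem4 n _ α β γ δ = record
  { to        = reflectOC
  ; cong      = λ {p} {q} → mirror-unique (reflectOC-mirror p) (reflectOC-mirror q)
  ; bijective =
      (λ {p} {q} → mirror-unique (mirror-sym (reflectOC-mirror p)) (mirror-sym (reflectOC-mirror q)))
    -- The preimage of `p` is its own reflection, since `mirror-sym` makes `p` the mirror image of
    -- that.
    , (λ p → reflectOC p , λ {q} → mirror-unique (reflectOC-mirror q) (mirror-sym (reflectOC-mirror p)))
  }
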